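{- Let $\mathcal{G}$ be a finite undirected graph on $n$ nodes with adjacency matrix $\mathbf{A}$. Then the exponential potential gain vector $\mathbf{e} = \left(\sum_{k=1}^{+\infty} \frac{1}{(k-1)!}\mathbf{A}^k\right)\mathbf{1}$ satisfies $$\mathbf{e} = \mathbf{A}\,\exp(\mathbf{A})\,\mathbf{1}.$$
   Context: The adjacency matrix $\mathbf{A}$ of an undirected graph on $n$ nodes is the symmetric $n\times n$ matrix with entry $a_{ij}=1$ if $\langle i,j\rangle$ is an edge and $0$ otherwise. $\mathbf{1}\in\mathbb{R}^n$ is the all-ones column vector, and $\exp(\mathbf{A})=\sum_{k=0}^{+\infty}\frac{1}{k!}\mathbf{A}^k$ is the matrix exponential. For a weight function $\phi$, the potential gain of a node $i$ is $p(i)=\sum_{j}\sum_{k\ge 1}\phi(k)\,w_k(j,i)$, where $w_k(j,i)=(\mathbf{A}^k)_{ji}$ is the number of walks of length $k$ from $j$ to $i$. In vector form it is $\left(\sum_{k\ge1}\phi(k)\mathbf{A}^k\right)\mathbf{1}$. The exponential potential gain $\mathbf{e}$ is the case $\phi(k)=\frac{1}{(k-1)!}$. -}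

module Defs where

open import Level using (0ℓ)
open import Algebra.Bundles.Raw using (RawMonoid)
import Algebra.Definitions.RawMonoid as RawMonoidDefs
open import Data.Bool.Base using (true; false; if_then_else_)
open import Data.Fin.Base using (Fin; zero; suc)
import Data.Fin.Properties as Fin
open import Data.Integer.Base as ℤ using (+_)
import Data.Integer.Properties as ℤ
open import Data.Nat.Base as ℕ using (ℕ; zero; suc; _⊔_; _∸_; _!; NonZero)
import Data.Nat.Properties as ℕ
open import Data.Product.Base using (∃; _×_; _,_; proj₁; proj₂)
open import Data.Rational.Base
  using (ℚ; 0ℚ; 1ℚ; ½; _/_; _+_; _*_; -_; _-_; 1/_; ∣_∣; _≤_; _<_; positive; nonNegative;
         toℚᵘ; fromℚᵘ)
import Data.Rational.Base as ℚ
import Data.Rational.Properties as ℚ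
open import Data.Rational.Solver using (module +-*-Solver)
open import Data.Rational.Unnormalised.Base as ℚᵘ using (mkℚᵘ; *≡*; *≤*)
import Data.Rational.Unnormalised.Properties as ℚᵘ
open import Data.Sum.Base using (inj₁; inj₂)
open import Data.Vec.Functional using (Vector)
open import Relation.Binary.Core using (Rel)
open import Relation.Binary.Definitions using (Symmetric; Decidable)
open import Relation.Binary.PropositionalEquality
  using (_≡_; refl; sym; trans; cong; cong₂; subst; subst₂)
open import Relation.Nullary.Decidable using (does; yes; no)

------------------------------------------------------------------------
-- Auxiliary facts about ℚ

0<* : ∀ {p q} → 0ℚ < p → 0ℚ < q → 0ℚ < p * q
0<* {p} {q} 0<p 0<q =
  ℚ.positive⁻¹ (p * q) {{ℚ.pos*pos⇒pos p {{positive 0<p}} q {{positive 0<q}}}}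

0≤* : ∀ {p q} → 0ℚ ≤ p → 0ℚ ≤ q → 0ℚ ≤ p * q
0≤* {p} {q} 0≤p 0≤q =
  subst (_≤ p * q) (ℚ.*-zeroʳ p) (ℚ.*-monoˡ-≤-nonNeg p {{nonNegative 0≤p}} 0≤q)

*-mono-≤ : ∀ {p q r s} → 0ℚ ≤ p → 0ℚ ≤ s → p ≤ q → r ≤ s → p * r ≤ q * s
*-mono-≤ {p} {q} {r} {s} 0≤p 0≤s p≤q r≤s = ℚ.≤-trans
  (ℚ.*-monoˡ-≤-nonNeg p {{nonNegative 0≤p}} r≤s)
  (ℚ.*-monoʳ-≤-nonNeg s {{nonNegative 0≤s}} p≤q)

0<½ : 0ℚ < ½
0<½ = ℚ.positive⁻¹ ½

0<1 : 0ℚ < 1ℚ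
0<1 = ℚ.positive⁻¹ 1ℚ

halves : ∀ p → p * ½ + p * ½ ≡ p
halves p = trans (sym (ℚ.*-distribˡ-+ p ½ ½)) (ℚ.*-identityʳ p)

three-quarters : ∀ {ε} → 0ℚ < ε → ε * ½ * ½ + (ε * ½ * ½ + ε * ½ * ½) ≤ ε
three-quarters {ε} 0<ε = subst₂ _≤_ (cong (λ q → δ + q) (sym (halves (ε * ½)))) (halves ε)
  (ℚ.+-monoˡ-≤ (ε * ½) (subst₂ _≤_ (ℚ.+-identityʳ δ) (halves (ε * ½))
    (ℚ.+-monoʳ-≤ δ (ℚ.<⇒≤ (0<* (0<* 0<ε 0<½) 0<½)))))
  where δ = ε * ½ * ½

∣p-p∣≡0 : ∀ p → ∣ p - p ∣ ≡ 0ℚ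
∣p-p∣≡0 p = cong ∣_∣ (ℚ.+-inverseʳ p)

∣-∣-comm : ∀ p q → ∣ p - q ∣ ≡ ∣ q - p ∣
∣-∣-comm p q = trans (sym (ℚ.∣-p∣≡∣p∣ (p - q)))
  (cong ∣_∣ (solve 2 (λ p q → :- (p :- q) := q :- p) refl p q))
  where open +-*-Solver

∣-∣-triangle : ∀ p q r → ∣ p - r ∣ ≤ ∣ p - q ∣ + ∣ q - r ∣
∣-∣-triangle p q r = subst (λ s → ∣ s ∣ ≤ ∣ p - q ∣ + ∣ q - r ∣)
  (solve 3 (λ p q r → (p :- q) :+ (q :- r) := p :- r) refl p q r)
  (ℚ.∣p+q∣≤∣p∣+∣q∣ (p - q) (q - r))
  where open +-*-Solver

p≤∣p∣ : ∀ p → p ≤ ∣ p ∣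
p≤∣p∣ p with ℚ.≤-total 0ℚ p
... | inj₁ 0≤p = ℚ.≤-reflexive (sym (ℚ.0≤p⇒∣p∣≡p 0≤p))
... | inj₂ p≤0 = ℚ.≤-trans p≤0 (ℚ.0≤∣p∣ p)

∣p∣≤q : ∀ {p q} → p ≤ q → - p ≤ q → ∣ p ∣ ≤ q
∣p∣≤q {p} {q} p≤q -p≤q with ℚ.∣p∣≡p∨∣p∣≡-p p
... | inj₁ eq = subst (_≤ q) (sym eq) p≤q
... | inj₂ eq = subst (_≤ q) (sym eq) -p≤q

∣∣p∣-∣q∣∣≤∣p-q∣ : ∀ p q → ∣ ∣ p ∣ - ∣ q ∣ ∣ ≤ ∣ p - q ∣
∣∣p∣-∣q∣∣≤∣p-q∣ p q = ∣p∣≤q (half p q)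
  (subst₂ _≤_ (solve 2 (λ a b → b :- a := :- (a :- b)) refl ∣ p ∣ ∣ q ∣)
    (∣-∣-comm q p) (half q p))
  where
  open +-*-Solver
  half : ∀ p q → ∣ p ∣ - ∣ q ∣ ≤ ∣ p - q ∣
  half p q = subst (∣ p ∣ - ∣ q ∣ ≤_)
    (solve 2 (λ a b → (a :+ b) :- b := a) refl ∣ p - q ∣ ∣ q ∣)
    (ℚ.+-monoˡ-≤ (- ∣ q ∣)
      (subst (λ s → ∣ s ∣ ≤ ∣ p - q ∣ + ∣ q ∣)
        (solve 2 (λ p q → (p :- q) :+ q := p) refl p q)
        (ℚ.∣p+q∣≤∣p∣+∣q∣ (p - q) q)))

fromℕ : ℕ → ℚ
fromℕ n = + n / 1

/-≃ : ∀ n d .{{_ : NonZero d}} → toℚᵘ (+ n / d) ℚᵘ.≃ (+ n ℚᵘ./ d)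
/-≃ n (suc d) = ℚ.toℚᵘ-fromℚᵘ (mkℚᵘ (+ n) d)

fromℕ-+ : ∀ m n → fromℕ (m ℕ.+ n) ≡ fromℕ m + fromℕ n
fromℕ-+ m n = ℚ.toℚᵘ-injective (begin
  toℚᵘ (fromℕ (m ℕ.+ n))              ≈⟨ /-≃ (m ℕ.+ n) 1 ⟩
  mkℚᵘ (+ (m ℕ.+ n)) 0                ≈⟨ *≡* (cong (ℤ._* + 1) (sym
                                            (cong₂ ℤ._+_ (ℤ.*-identityʳ (+ m)) (ℤ.*-identityʳ (+ n))))) ⟩
  mkℚᵘ (+ m) 0 ℚᵘ.+ mkℚᵘ (+ n) 0      ≈⟨ ℚᵘ.+-cong (/-≃ m 1) (/-≃ n 1) ⟨
  toℚᵘ (fromℕ m) ℚᵘ.+ toℚᵘ (fromℕ n)  ≈⟨ ℚ.toℚᵘ-homo-+ (fromℕ m) (fromℕ n) ⟨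
  toℚᵘ (fromℕ m + fromℕ n)            ∎)
  where open import Relation.Binary.Reasoning.Setoid ℚᵘ.≃-setoid

0≤fromℕ : ∀ n → 0ℚ ≤ fromℕ n
0≤fromℕ n = ℚ.nonNegative⁻¹ (fromℕ n) {{ℚ.normalize-nonNeg n 1}}

fromℕ-mono-≤ : ∀ {m n} → m ℕ.≤ n → fromℕ m ≤ fromℕ n
fromℕ-mono-≤ {m} {n} m≤n = subst (fromℕ m ≤_)
  (trans (sym (fromℕ-+ m (n ∸ m))) (cong fromℕ (ℕ.m+[n∸m]≡n m≤n)))
  (subst (_≤ fromℕ m + fromℕ (n ∸ m)) (ℚ.+-identityʳ (fromℕ m))
    (ℚ.+-monoʳ-≤ (fromℕ m) (0≤fromℕ (n ∸ m))))

0<fromℕ-suc : ∀ n → 0ℚ < fromℕ (suc n)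
0<fromℕ-suc n = ℚ.<-≤-trans 0<1 (fromℕ-mono-≤ {1} {suc n} (ℕ.s≤s ℕ.z≤n))

1/n*m : ∀ m n .{{_ : NonZero m}} .{{_ : NonZero n}} .{{_ : NonZero (m ℕ.* n)}} →
        (+ 1 / (m ℕ.* n)) * fromℕ m ≡ + 1 / n
1/n*m (suc m) (suc n) = ℚ.toℚᵘ-injective (begin
  toℚᵘ ((+ 1 / (suc m ℕ.* suc n)) * fromℕ (suc m))
    ≈⟨ ℚ.toℚᵘ-homo-* (+ 1 / (suc m ℕ.* suc n)) (fromℕ (suc m)) ⟩
  toℚᵘ (+ 1 / (suc m ℕ.* suc n)) ℚᵘ.* toℚᵘ (fromℕ (suc m))
    ≈⟨ ℚᵘ.*-cong (/-≃ 1 (suc m ℕ.* suc n)) (/-≃ (suc m) 1) ⟩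
  (+ 1 ℚᵘ./ (suc m ℕ.* suc n)) ℚᵘ.* mkℚᵘ (+ suc m) 0
    ≈⟨ *≡* (cong +_ eq) ⟩
  + 1 ℚᵘ./ suc n
    ≈⟨ /-≃ 1 (suc n) ⟨
  toℚᵘ (+ 1 / suc n) ∎)
  where
  open import Relation.Binary.Reasoning.Setoid ℚᵘ.≃-setoid
  eq : (1 ℕ.* suc m) ℕ.* suc n ≡ 1 ℕ.* ((suc m ℕ.* suc n) ℕ.* 1)
  eq = trans (cong (ℕ._* suc n) (ℕ.*-identityˡ (suc m)))
    (sym (trans (ℕ.*-identityˡ _) (ℕ.*-identityʳ (suc m ℕ.* suc n))))

archimedean : ∀ q → ∃ λ n → q < fromℕ n
archimedean q = suc n , ℚ.≤-<-trans q≤n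
  (subst₂ _<_ (ℚ.+-identityˡ (fromℕ n)) (sym (fromℕ-+ 1 n))
    (ℚ.+-monoˡ-< (fromℕ n) 0<1))
  where
  n = ℤ.∣ ℚ.↥ q ∣
  z≤∣z∣ : ∀ z → z ℤ.≤ + ℤ.∣ z ∣
  z≤∣z∣ (+ k) = ℤ.≤-refl
  z≤∣z∣ (ℤ.-[1+ k ]) = ℤ.-≤+
  q≤nᵘ : toℚᵘ q ℚᵘ.≤ mkℚᵘ (+ n) 0
  q≤nᵘ = *≤* (ℤ.≤-trans
    (ℤ.≤-reflexive (trans (cong (ℤ._* + 1) (ℚ.↥ᵘ-toℚᵘ q)) (ℤ.*-identityʳ (ℚ.↥ q))))
    (ℤ.≤-trans (z≤∣z∣ (ℚ.↥ q))
      (ℤ.≤-trans (ℤ.+≤+ (ℕ.m≤m*n n (ℚ.↧ₙ q)))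
        (ℤ.≤-reflexive (trans (ℤ.pos-* n (ℚ.↧ₙ q))
          (cong (+ n ℤ.*_) (sym (ℚ.↧ᵘ-toℚᵘ q))))))))
  q≤n : q ≤ fromℕ n
  q≤n = ℚ.toℚᵘ-cancel-≤ (ℚᵘ.≤-trans q≤nᵘ (ℚᵘ.≤-reflexive (ℚᵘ.≃-sym (/-≃ n 1))))

archimedean-* : ∀ ε → 0ℚ < ε → ∀ q → ∃ λ N → ∀ n → N ℕ.≤ n → q < ε * fromℕ (suc n)
archimedean-* ε 0<ε q = N , λ n N≤n → subst (_< ε * fromℕ (suc n)) eq
  (ℚ.*-monoʳ-<-pos ε {{εpos}}
    (ℚ.<-≤-trans (proj₂ (archimedean (1/ε * q))) (fromℕ-mono-≤ (ℕ.m≤n⇒m≤1+n N≤n))))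
  where
  εpos = positive 0<ε
  instance
    ε≢0 : ℚ.NonZero ε
    ε≢0 = ℚ.pos⇒nonZero ε {{positive 0<ε}}
  1/ε = 1/ ε
  N = proj₁ (archimedean (1/ε * q))
  eq : ε * (1/ε * q) ≡ q
  eq = trans (sym (ℚ.*-assoc ε 1/ε q))
    (trans (cong (_* q) (ℚ.*-inverseʳ ε)) (ℚ.*-identityˡ q))

1/1+n<ε : ∀ ε → 0ℚ < ε → ∃ λ N → ∀ n → N ℕ.≤ n → + 1 / suc n < ε
1/1+n<ε ε 0<ε = N , λ n N≤n →
  ℚ.*-cancelʳ-<-nonNeg (fromℕ (suc n)) {{nonNegative (0≤fromℕ (suc n))}}
    (subst (_< ε * fromℕ (suc n)) (sym (eq n)) (proj₂ (archimedean-* ε 0<ε 1ℚ) n N≤n))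
  where
  N = proj₁ (archimedean-* ε 0<ε 1ℚ)
  eq : ∀ n → (+ 1 / suc n) * fromℕ (suc n) ≡ 1ℚ
  eq n = trans
    (cong (_* fromℕ (suc n)) (ℚ./-cong {+ 1} refl (sym (ℕ.*-identityʳ (suc n)))))
    (1/n*m (suc n) 1)

------------------------------------------------------------------------
-- The real numbers, as Cauchy sequences of rationals (with modulus)

IsCauchyℚ : (ℕ → ℚ) → Set
IsCauchyℚ x = ∀ ε → 0ℚ < ε → ∃ λ N → ∀ m n → N ℕ.≤ m → N ℕ.≤ n → ∣ x m - x n ∣ < ε

record ℝ : Set where
  no-eta-equality
  constructor mkℝ
  field
    seq    : ℕ → ℚ
    cauchy : IsCauchyℚ seq

open ℝ public

infix  4 _≃_ _≤ᴿ_
infixl 6 _+ᴿ_ _-ᴿ_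
infixl 7 _*ᴿ_

_≃_ : Rel ℝ 0ℓ
x ≃ y = ∀ ε → 0ℚ < ε → ∃ λ N → ∀ n → N ℕ.≤ n → ∣ seq x n - seq y n ∣ < ε

_≤ᴿ_ : Rel ℝ 0ℓ
x ≤ᴿ y = ∀ ε → 0ℚ < ε → ∃ λ N → ∀ n → N ℕ.≤ n → seq x n ≤ seq y n + ε

-- The proofs are abstract, so that comparing two reals never compares
-- their moduli of convergence in unfolded form.
abstract

  const-cauchy : ∀ q → IsCauchyℚ (λ _ → q)
  const-cauchy q ε 0<ε = 0 , λ _ _ _ _ → subst (_< ε) (sym (∣p-p∣≡0 q)) 0<ε

  +-cauchy : ∀ x y → IsCauchyℚ (λ n → seq x n + seq y n)
  +-cauchy x y ε 0<ε =
    let δ = ε * ½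
        0<δ = 0<* 0<ε 0<½
        (N₁ , h₁) = cauchy x δ 0<δ
        (N₂ , h₂) = cauchy y δ 0<δ
    in N₁ ⊔ N₂ , λ m n N≤m N≤n → ℚ.≤-<-trans
      (subst (λ s → ∣ s ∣ ≤ ∣ seq x m - seq x n ∣ + ∣ seq y m - seq y n ∣)
        (rearrange (seq x m) (seq x n) (seq y m) (seq y n))
        (ℚ.∣p+q∣≤∣p∣+∣q∣ (seq x m - seq x n) (seq y m - seq y n)))
      (subst (∣ seq x m - seq x n ∣ + ∣ seq y m - seq y n ∣ <_) (halves ε)
        (ℚ.+-mono-<
          (h₁ m n (ℕ.m⊔n≤o⇒m≤o N₁ N₂ N≤m) (ℕ.m⊔n≤o⇒m≤o N₁ N₂ N≤n))
          (h₂ m n (ℕ.m⊔n≤o⇒n≤o N₁ N₂ N≤m) (ℕ.m⊔n≤o⇒n≤o N₁ N₂ N≤n))))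
    where
    open +-*-Solver
    rearrange : ∀ a b c d → (a - b) + (c - d) ≡ (a + c) - (b + d)
    rearrange = solve 4 (λ a b c d → (a :- b) :+ (c :- d) := (a :+ c) :- (b :+ d)) refl

  neg-cauchy : ∀ x → IsCauchyℚ (λ n → - seq x n)
  neg-cauchy x ε 0<ε =
    let (N , h) = cauchy x ε 0<ε
    in N , λ m n N≤m N≤n → subst (_< ε)
      (trans (∣-∣-comm (seq x m) (seq x n)) (cong ∣_∣ (rearrange (seq x m) (seq x n))))
      (h m n N≤m N≤n)
    where
    open +-*-Solver
    rearrange : ∀ a b → b - a ≡ - a - - b
    rearrange = solve 2 (λ a b → b :- a := :- a :- :- b) refl

  ∣∣-cauchy : ∀ x → IsCauchyℚ (λ n → ∣ seq x n ∣)
  ∣∣-cauchy x ε 0<ε =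
    let (N , h) = cauchy x ε 0<ε
    in N , λ m n N≤m N≤n →
      ℚ.≤-<-trans (∣∣p∣-∣q∣∣≤∣p-q∣ (seq x m) (seq x n)) (h m n N≤m N≤n)

  max-∣∣ : (x : ℕ → ℚ) (N : ℕ) → ∃ λ K → ∀ n → n ℕ.≤ N → ∣ x n ∣ ≤ K
  max-∣∣ x zero = ∣ x 0 ∣ , λ { zero ℕ.z≤n → ℚ.≤-refl }
  max-∣∣ x (suc N) with max-∣∣ x N
  ... | K , h = K ℚ.⊔ ∣ x (suc N) ∣ , g
    where
    g : ∀ n → n ℕ.≤ suc N → ∣ x n ∣ ≤ K ℚ.⊔ ∣ x (suc N) ∣
    g n n≤ with ℕ.m≤n⇒m<n∨m≡n n≤
    ... | inj₁ (ℕ.s≤s n≤N) = ℚ.≤-trans (h n n≤N) (ℚ.p≤p⊔q K ∣ x (suc N) ∣)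
    ... | inj₂ refl = ℚ.p≤q⊔p K ∣ x (suc N) ∣

  bounded : ∀ x → ∃ λ c → ∀ n → ∣ seq x n ∣ ≤ fromℕ c
  bounded x = proj₁ (archimedean (K + 1ℚ)) , λ n → ℚ.≤-trans (g n) (ℚ.<⇒≤ (proj₂ (archimedean (K + 1ℚ))))
    where
    N : ℕ
    N = proj₁ (cauchy x 1ℚ 0<1)
    K : ℚ
    K = proj₁ (max-∣∣ (seq x) N)
    ∣xN∣≤K : ∀ n → n ℕ.≤ N → ∣ seq x n ∣ ≤ K
    ∣xN∣≤K = proj₂ (max-∣∣ (seq x) N)
    open +-*-Solver
    g : ∀ n → ∣ seq x n ∣ ≤ K + 1ℚ
    g n with ℕ.≤-total n N
    ... | inj₁ n≤N = ℚ.≤-trans (∣xN∣≤K n n≤N)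
      (subst (_≤ K + 1ℚ) (ℚ.+-identityʳ K) (ℚ.+-monoʳ-≤ K (ℚ.<⇒≤ 0<1)))
    ... | inj₂ N≤n = ℚ.≤-trans
      (subst (λ s → ∣ s ∣ ≤ ∣ seq x N ∣ + ∣ seq x n - seq x N ∣)
        (solve 2 (λ a b → b :+ (a :- b) := a) refl (seq x n) (seq x N))
        (ℚ.∣p+q∣≤∣p∣+∣q∣ (seq x N) (seq x n - seq x N)))
      (ℚ.+-mono-≤ (∣xN∣≤K N ℕ.≤-refl)
        (ℚ.<⇒≤ (proj₂ (cauchy x 1ℚ 0<1) n N N≤n ℕ.≤-refl)))

  *-cauchy : ∀ x y → IsCauchyℚ (λ n → seq x n * seq y n)
  *-cauchy x y ε 0<ε =
    let instance
          K≢0 = ℚ.pos⇒nonZero K {{positive 0<K}}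
        δ = ε * 1/ K
        0<δ = 0<* 0<ε (ℚ.positive⁻¹ (1/ K) {{ℚ.1/pos⇒pos K {{positive 0<K}}}})
        (N₁ , h₁) = cauchy x δ 0<δ
        (N₂ , h₂) = cauchy y δ 0<δ
    in N₁ ⊔ N₂ , λ m n N≤m N≤n → ℚ.≤-<-trans
      (estimate δ m n
        (ℚ.<⇒≤ (h₁ m n (ℕ.m⊔n≤o⇒m≤o N₁ N₂ N≤m) (ℕ.m⊔n≤o⇒m≤o N₁ N₂ N≤n)))
        (ℚ.<⇒≤ (h₂ m n (ℕ.m⊔n≤o⇒n≤o N₁ N₂ N≤m) (ℕ.m⊔n≤o⇒n≤o N₁ N₂ N≤n))))
      (subst ((a + b) * δ <_)
        (trans (ℚ.*-comm K δ) (trans (ℚ.*-assoc ε (1/ K) K)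
          (trans (cong (ε *_) (ℚ.*-inverseˡ K)) (ℚ.*-identityʳ ε))))
        (ℚ.*-monoˡ-<-pos δ {{positive 0<δ}}
          (subst (_< K) (ℚ.+-identityˡ (a + b)) (ℚ.+-monoˡ-< (a + b) 0<1))))
    where
    open +-*-Solver
    a b K : ℚ
    a = fromℕ (proj₁ (bounded x))
    b = fromℕ (proj₁ (bounded y))
    0≤a : 0ℚ ≤ a
    0≤a = 0≤fromℕ (proj₁ (bounded x))
    0≤b : 0ℚ ≤ b
    0≤b = 0≤fromℕ (proj₁ (bounded y))
    K = 1ℚ + (a + b)
    0<K : 0ℚ < K
    0<K = ℚ.+-mono-<-≤ 0<1 (ℚ.+-mono-≤ 0≤a 0≤b)
    estimate : ∀ δ m n → ∣ seq x m - seq x n ∣ ≤ δ → ∣ seq y m - seq y n ∣ ≤ δ →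
               ∣ seq x m * seq y m - seq x n * seq y n ∣ ≤ (a + b) * δ
    estimate δ m n hx hy = subst₂ _≤_
      (cong ∣_∣ (solve 4 (λ p q r s → p :* (r :- s) :+ s :* (p :- q) := p :* r :- q :* s) refl
        (seq x m) (seq x n) (seq y m) (seq y n)))
      (sym (ℚ.*-distribʳ-+ δ a b))
      (ℚ.≤-trans (ℚ.∣p+q∣≤∣p∣+∣q∣ (seq x m * (seq y m - seq y n)) (seq y n * (seq x m - seq x n)))
        (ℚ.+-mono-≤
          (subst (_≤ a * δ) (sym (ℚ.∣p*q∣≡∣p∣*∣q∣ (seq x m) (seq y m - seq y n)))
            (*-mono-≤ (ℚ.0≤∣p∣ (seq x m)) 0≤δ (proj₂ (bounded x) m) hy))
          (subst (_≤ b * δ) (sym (ℚ.∣p*q∣≡∣p∣*∣q∣ (seq y n) (seq x m - seq x n)))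
            (*-mono-≤ (ℚ.0≤∣p∣ (seq y n)) 0≤δ (proj₂ (bounded y) n) hx))))
      where
      0≤δ : 0ℚ ≤ δ
      0≤δ = ℚ.≤-trans (ℚ.0≤∣p∣ (seq x m - seq x n)) hx

fromℚ : ℚ → ℝ
fromℚ q = mkℝ (λ _ → q) (const-cauchy q)

0ℝ 1ℝ : ℝ
0ℝ = fromℚ 0ℚ
1ℝ = fromℚ 1ℚ

_+ᴿ_ : ℝ → ℝ → ℝ
x +ᴿ y = mkℝ (λ n → seq x n + seq y n) (+-cauchy x y)

-ᴿ_ : ℝ → ℝ
-ᴿ x = mkℝ (λ n → - seq x n) (neg-cauchy x)

_-ᴿ_ : ℝ → ℝ → ℝ
x -ᴿ y = x +ᴿ (-ᴿ y)

∣_∣ᴿ : ℝ → ℝ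
∣ x ∣ᴿ = mkℝ (λ n → ∣ seq x n ∣) (∣∣-cauchy x)

_*ᴿ_ : ℝ → ℝ → ℝ
x *ᴿ y = mkℝ (λ n → seq x n * seq y n) (*-cauchy x y)

------------------------------------------------------------------------
-- Limits and series of real numbers. Quantifying over rational ε loses
-- nothing, as every positive real exceeds a positive rational.

infix 4 _⟶_

_⟶_ : (ℕ → ℝ) → ℝ → Set
x ⟶ l = ∀ ε → 0ℚ < ε → ∃ λ N → ∀ n → N ℕ.≤ n → ∣ x n -ᴿ l ∣ᴿ ≤ᴿ fromℚ ε

IsCauchy : (ℕ → ℝ) → Set
IsCauchy x = ∀ ε → 0ℚ < ε → ∃ λ N → ∀ m n → N ℕ.≤ m → N ℕ.≤ n → ∣ x m -ᴿ x n ∣ᴿ ≤ᴿ fromℚ ε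

-- The n-th term of the limit is a rational within 1/(n+1) of x n.
module Limit (x : ℕ → ℝ) (c : IsCauchy x) where

  modulus : ∀ n → ∃ λ N → ∀ i j → N ℕ.≤ i → N ℕ.≤ j → ∣ seq (x n) i - seq (x n) j ∣ < + 1 / suc n
  modulus n = cauchy (x n) (+ 1 / suc n) (ℚ.positive⁻¹ (+ 1 / suc n) {{ℚ.normalize-pos 1 (suc n)}})

  μ : ℕ → ℕ
  μ n = proj₁ (modulus n)

  approx : ℕ → ℚ
  approx n = seq (x n) (μ n)

  approx-close : ∀ δ → 0ℚ < δ → ∃ λ N → ∀ n → N ℕ.≤ n →
                 ∀ i → μ n ℕ.≤ i → ∣ seq (x n) i - approx n ∣ < δ
  approx-close δ 0<δ =
    let (N , h) = 1/1+n<ε δ 0<δ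
    in N , λ n N≤n i μ≤i →
      ℚ.<-trans (proj₂ (modulus n) i (μ n) μ≤i ℕ.≤-refl) (h n N≤n)

  terms-close : ∀ δ → 0ℚ < δ → ∃ λ N → ∀ m n → N ℕ.≤ m → N ℕ.≤ n →
                ∃ λ P → ∀ i → P ℕ.≤ i → ∣ seq (x m) i - seq (x n) i ∣ ≤ δ
  terms-close δ 0<δ =
    let (N , h) = c (δ * ½) (0<* 0<δ 0<½)
    in N , λ m n N≤m N≤n →
      let (P , g) = h m n N≤m N≤n (δ * ½) (0<* 0<δ 0<½)
      in P , λ i P≤i → subst (∣ seq (x m) i - seq (x n) i ∣ ≤_) (halves δ) (g i P≤i)

  approx-cauchy : IsCauchyℚ approx
  approx-cauchy ε 0<ε = N₁ ⊔ N₂ , g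
    where
    δ = ε * ½ * ½
    0<δ : 0ℚ < δ
    0<δ = 0<* (0<* 0<ε 0<½) 0<½
    N₁ = proj₁ (approx-close δ 0<δ)
    N₂ = proj₁ (terms-close δ 0<δ)
    g : ∀ m n → N₁ ⊔ N₂ ℕ.≤ m → N₁ ⊔ N₂ ℕ.≤ n → ∣ approx m - approx n ∣ < ε
    g m n N≤m N≤n = ℚ.≤-<-trans
      (ℚ.≤-trans (∣-∣-triangle (approx m) (seq (x m) i) (approx n))
        (ℚ.+-monoʳ-≤ ∣ approx m - seq (x m) i ∣
          (∣-∣-triangle (seq (x m) i) (seq (x n) i) (approx n))))
      (ℚ.<-≤-trans
        (ℚ.+-mono-<
          (subst (_< δ) (∣-∣-comm (seq (x m) i) (approx m))
            (proj₂ (approx-close δ 0<δ) m (ℕ.m⊔n≤o⇒m≤o N₁ N₂ N≤m) i μm≤i))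
          (ℚ.+-mono-≤-<
            (proj₂ close i P≤i)
            (proj₂ (approx-close δ 0<δ) n (ℕ.m⊔n≤o⇒m≤o N₁ N₂ N≤n) i μn≤i)))
        (three-quarters 0<ε))
      where
      close = terms-close δ 0<δ .proj₂ m n (ℕ.m⊔n≤o⇒n≤o N₁ N₂ N≤m) (ℕ.m⊔n≤o⇒n≤o N₁ N₂ N≤n)
      P = proj₁ close
      i = P ⊔ (μ m ⊔ μ n)
      P≤i : P ℕ.≤ i
      P≤i = ℕ.m≤m⊔n P (μ m ⊔ μ n)
      μm≤i : μ m ℕ.≤ i
      μm≤i = ℕ.≤-trans (ℕ.m≤m⊔n (μ m) (μ n)) (ℕ.m≤n⊔m P (μ m ⊔ μ n))
      μn≤i : μ n ℕ.≤ i
      μn≤i = ℕ.≤-trans (ℕ.m≤n⊔m (μ m) (μ n)) (ℕ.m≤n⊔m P (μ m ⊔ μ n))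

  limit : ℝ
  limit = mkℝ approx approx-cauchy

  converges : x ⟶ limit
  converges ε 0<ε = N₁ ⊔ N₂ , λ n N≤n ε′ 0<ε′ → P n , λ i P≤i →
    ℚ.≤-trans (g n i (ℕ.m⊔n≤o⇒n≤o N₁ N₂ N≤n) P≤i)
      (subst (_≤ ε + ε′) (ℚ.+-identityʳ ε) (ℚ.+-monoʳ-≤ ε (ℚ.<⇒≤ 0<ε′)))
    where
    δ = ε * ½ * ½
    0<δ : 0ℚ < δ
    0<δ = 0<* (0<* 0<ε 0<½) 0<½
    N₁ = proj₁ (approx-close δ 0<δ)
    N₂ = proj₁ (terms-close δ 0<δ)
    P : ℕ → ℕ
    P n = proj₁ (cauchy (x n) δ 0<δ) ⊔ (N₁ ⊔ N₂)
    g : ∀ n i → N₂ ℕ.≤ n → P n ℕ.≤ i → ∣ seq (x n) i - approx i ∣ ≤ ε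
    g n i N₂≤n P≤i = ℚ.≤-trans
      (ℚ.≤-trans (∣-∣-triangle (seq (x n) i) (seq (x n) j) (approx i))
        (ℚ.+-monoʳ-≤ ∣ seq (x n) i - seq (x n) j ∣
          (∣-∣-triangle (seq (x n) j) (seq (x i) j) (approx i))))
      (ℚ.≤-trans
        (ℚ.+-mono-≤
          (ℚ.<⇒≤ (proj₂ (cauchy (x n) δ 0<δ) i j M≤i (ℕ.≤-trans M≤i i≤j)))
          (ℚ.+-mono-≤
            (proj₂ close j (ℕ.≤-trans (ℕ.m≤m⊔n Q (μ i)) (ℕ.m≤n⊔m i (Q ⊔ μ i))))
            (ℚ.<⇒≤ (proj₂ (approx-close δ 0<δ) i N₁≤i j
              (ℕ.≤-trans (ℕ.m≤n⊔m Q (μ i)) (ℕ.m≤n⊔m i (Q ⊔ μ i)))))))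
        (three-quarters 0<ε))
      where
      M = proj₁ (cauchy (x n) δ 0<δ)
      M≤i : M ℕ.≤ i
      M≤i = ℕ.m⊔n≤o⇒m≤o M (N₁ ⊔ N₂) P≤i
      N≤i : N₁ ⊔ N₂ ℕ.≤ i
      N≤i = ℕ.m⊔n≤o⇒n≤o M (N₁ ⊔ N₂) P≤i
      N₁≤i : N₁ ℕ.≤ i
      N₁≤i = ℕ.m⊔n≤o⇒m≤o N₁ N₂ N≤i
      close = terms-close δ 0<δ .proj₂ n i N₂≤n (ℕ.m⊔n≤o⇒n≤o N₁ N₂ N≤i)
      Q = proj₁ close
      j = i ⊔ (Q ⊔ μ i)
      i≤j : i ℕ.≤ j
      i≤j = ℕ.m≤m⊔n i (Q ⊔ μ i)

lim : (x : ℕ → ℝ) → IsCauchy x → ℝ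
lim = Limit.limit

lim-converges : ∀ x (c : IsCauchy x) → x ⟶ lim x c
lim-converges = Limit.converges

partialSum : (ℕ → ℝ) → ℕ → ℝ
partialSum a zero    = 0ℝ
partialSum a (suc n) = partialSum a n +ᴿ a n

Summable : (ℕ → ℝ) → Set
Summable a = IsCauchy (partialSum a)

∑∞ : (a : ℕ → ℝ) → Summable a → ℝ
∑∞ a = lim (partialSum a)

------------------------------------------------------------------------
-- Real vectors and square matrices

+ᴿ-rawMonoid : RawMonoid 0ℓ 0ℓ
+ᴿ-rawMonoid = record { Carrier = ℝ ; _≈_ = _≃_ ; _∙_ = _+ᴿ_ ; ε = 0ℝ }

open RawMonoidDefs +ᴿ-rawMonoid public using (sum)

Matrix : ℕ → Set
Matrix n = Fin n → Fin n → ℝ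

infix  4 _≃ᵛ_
infixl 7 _*ᴹ_
infixr 7 _·ᴹ_
infixr 7 _*ᵛ_
infixr 8 _^ᴹ_

_≃ᵛ_ : ∀ {n} → Rel (Vector ℝ n) 0ℓ
u ≃ᵛ v = ∀ i → u i ≃ v i

𝟏 : ∀ {n} → Vector ℝ n
𝟏 _ = 1ℝ

identity : ∀ {n} → Matrix n
identity i j = if does (i Fin.≟ j) then 1ℝ else 0ℝ

_·ᴹ_ : ∀ {n} → ℝ → Matrix n → Matrix n
(c ·ᴹ A) i j = c *ᴿ A i j

_*ᴹ_ : ∀ {n} → Matrix n → Matrix n → Matrix n
(A *ᴹ B) i j = sum (λ k → A i k *ᴿ B k j)

_*ᵛ_ : ∀ {n} → Matrix n → Vector ℝ n → Vector ℝ n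
(A *ᵛ v) i = sum (λ j → A i j *ᴿ v j)

_^ᴹ_ : ∀ {n} → Matrix n → ℕ → Matrix n
A ^ᴹ zero  = identity
A ^ᴹ suc k = A *ᴹ A ^ᴹ k

-- Convergence of matrices is entrywise.
Summableᴹ : ∀ {n} → (ℕ → Matrix n) → Set
Summableᴹ F = ∀ i j → Summable (λ k → F k i j)

∑∞ᴹ : ∀ {n} (F : ℕ → Matrix n) → Summableᴹ F → Matrix n
∑∞ᴹ F s i j = ∑∞ (λ k → F k i j) (s i j)

inv! : ℕ → ℚ
inv! k = (+ 1 / (k !)) {{k ℕ.!≢0}}

------------------------------------------------------------------------
-- Convergence of the series Σ Aᵏ/k! and Σ Aᵏ⁺¹/k!

-- A series whose terms are dominated by a rational sequence t that is
-- eventually decreasing with ratio at most ½.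
module RatioTest
  (a : ℕ → ℝ) (t : ℕ → ℚ) (M : ℕ)
  (dominated : ∀ k i → ∣ seq (a k) i ∣ ≤ t k)
  (ratio : ∀ k → M ℕ.≤ k → t (suc k) ≤ t k * ½)
  where

  0≤t : ∀ k → 0ℚ ≤ t k
  0≤t k = ℚ.≤-trans (ℚ.0≤∣p∣ (seq (a k) 0)) (dominated k 0)

  twice-ratio : ∀ k → M ℕ.≤ k → t (suc k) + t (suc k) ≤ t k
  twice-ratio k M≤k = subst (t (suc k) + t (suc k) ≤_) (halves (t k))
    (ℚ.+-mono-≤ (ratio k M≤k) (ratio k M≤k))

  S : ℕ → ℕ → ℚ
  S i m = seq (partialSum a m) i

  tail′ : ∀ i m q → M ℕ.≤ m →
          ∣ S i (q ℕ.+ m) - S i m ∣ + (t (q ℕ.+ m) + t (q ℕ.+ m)) ≤ t m + t m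
  tail′ i m zero M≤m = ℚ.≤-reflexive
    (trans (cong (_+ (t m + t m)) (∣p-p∣≡0 (S i m))) (ℚ.+-identityˡ (t m + t m)))
  tail′ i m (suc q) M≤m = ℚ.≤-trans
    (ℚ.+-mono-≤
      (subst (λ s → ∣ s ∣ ≤ ∣ S i k - S i m ∣ + t k)
        (solve 3 (λ s u v → (s :- u) :+ v := (s :+ v) :- u) refl (S i k) (S i m) (seq (a k) i))
        (ℚ.≤-trans (ℚ.∣p+q∣≤∣p∣+∣q∣ (S i k - S i m) (seq (a k) i))
          (ℚ.+-monoʳ-≤ ∣ S i k - S i m ∣ (dominated k i))))
      (twice-ratio k (ℕ.≤-trans M≤m (ℕ.m≤n+m m q))))
    (subst (_≤ t m + t m) (sym (ℚ.+-assoc ∣ S i k - S i m ∣ (t k) (t k))) (tail′ i m q M≤m))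
    where
    open +-*-Solver
    k = q ℕ.+ m

  tail : ∀ i m n → M ℕ.≤ m → m ℕ.≤ n → ∣ S i n - S i m ∣ ≤ t m + t m
  tail i m n M≤m m≤n = subst (λ k → ∣ S i k - S i m ∣ ≤ t m + t m) (ℕ.m∸n+n≡m m≤n)
    (ℚ.≤-trans
      (subst (_≤ ∣ S i k - S i m ∣ + (t k + t k)) (ℚ.+-identityʳ ∣ S i k - S i m ∣)
        (ℚ.+-monoʳ-≤ ∣ S i k - S i m ∣ (ℚ.+-mono-≤ (0≤t k) (0≤t k))))
      (tail′ i m (n ∸ m) M≤m))
    where k = (n ∸ m) ℕ.+ m

  decay : ∀ j → t (j ℕ.+ M) * fromℕ (suc j) ≤ t M
  decay zero = ℚ.≤-reflexive (ℚ.*-identityʳ (t M))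
  decay (suc j) = ℚ.≤-trans
    (ℚ.≤-trans
      (ℚ.*-monoʳ-≤-nonNeg r₂ {{nonNegative (0≤fromℕ (suc (suc j)))}} (ratio k (ℕ.m≤n+m M j)))
      (subst (_≤ t k * r₁) (sym (ℚ.*-assoc (t k) ½ r₂))
        (ℚ.*-monoˡ-≤-nonNeg (t k) {{nonNegative (0≤t k)}} ½r₂≤r₁)))
    (decay j)
    where
    k = j ℕ.+ M
    r₁ = fromℕ (suc j)
    r₂ = fromℕ (suc (suc j))
    ½r₂≤r₁ : ½ * r₂ ≤ r₁
    ½r₂≤r₁ = subst₂ _≤_
      (trans (cong (_* ½) (sym (fromℕ-+ 1 (suc j)))) (ℚ.*-comm r₂ ½))
      (trans (ℚ.*-distribʳ-+ ½ r₁ r₁) (halves r₁))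
      (ℚ.*-monoʳ-≤-nonNeg ½ (ℚ.+-monoˡ-≤ r₁ (fromℕ-mono-≤ {1} {suc j} (ℕ.s≤s ℕ.z≤n))))

  small : ∀ ε → 0ℚ < ε → ∃ λ N → M ℕ.≤ N × (∀ n → N ℕ.≤ n → t n < ε)
  small ε 0<ε = J ℕ.+ M , ℕ.m≤n+m M J , g
    where
    J = proj₁ (archimedean-* ε 0<ε (t M))
    h = proj₂ (archimedean-* ε 0<ε (t M))
    g : ∀ n → J ℕ.+ M ℕ.≤ n → t n < ε
    g n N≤n = subst (λ k → t k < ε) (ℕ.m∸n+n≡m (ℕ.m+n≤o⇒n≤o J N≤n))
      (ℚ.*-cancelʳ-<-nonNeg (fromℕ (suc j)) {{nonNegative (0≤fromℕ (suc j))}}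
        (ℚ.≤-<-trans (decay j) (h j (ℕ.m+n≤o⇒m≤o∸n J N≤n))))
      where j = n ∸ M

  summable : Summable a
  summable ε 0<ε = N , λ m n N≤m N≤n ε′ 0<ε′ → 0 , λ i _ →
    ℚ.≤-trans (close i m n N≤m N≤n)
      (subst (_≤ ε + ε′) (ℚ.+-identityʳ ε) (ℚ.+-monoʳ-≤ ε (ℚ.<⇒≤ 0<ε′)))
    where
    N = proj₁ (small (ε * ½) (0<* 0<ε 0<½))
    M≤N = proj₁ (proj₂ (small (ε * ½) (0<* 0<ε 0<½)))
    h = proj₂ (proj₂ (small (ε * ½) (0<* 0<ε 0<½)))
    ordered : ∀ i m n → N ℕ.≤ m → m ℕ.≤ n → ∣ S i n - S i m ∣ ≤ ε
    ordered i m n N≤m m≤n = ℚ.≤-trans (tail i m n (ℕ.≤-trans M≤N N≤m) m≤n)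
      (subst (t m + t m ≤_) (halves ε)
        (ℚ.+-mono-≤ (ℚ.<⇒≤ (h m N≤m)) (ℚ.<⇒≤ (h m N≤m))))
    close : ∀ i m n → N ℕ.≤ m → N ℕ.≤ n → ∣ S i m - S i n ∣ ≤ ε
    close i m n N≤m N≤n with ℕ.≤-total m n
    ... | inj₁ m≤n = subst (_≤ ε) (∣-∣-comm (S i n) (S i m)) (ordered i m n N≤m m≤n)
    ... | inj₂ n≤m = ordered i n m N≤n n≤m

fin-bound : ∀ {n} (f : Fin n → ℕ) → ∃ λ C → ∀ i → f i ℕ.≤ C
fin-bound {zero} f = 0 , λ ()
fin-bound {suc n} f with fin-bound (λ i → f (suc i))
... | C , h = f zero ⊔ C , λ
  { zero    → ℕ.m≤m⊔n (f zero) C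
  ; (suc i) → ℕ.≤-trans (h i) (ℕ.m≤n⊔m (f zero) C) }

sum-bound : ∀ {n} (v : Vector ℝ n) C T p → (∀ l → ∣ seq (v l) p ∣ ≤ fromℕ C * T) →
            ∣ seq (sum v) p ∣ ≤ fromℕ (n ℕ.* C) * T
sum-bound {zero} v C T p h = ℚ.≤-reflexive (sym (ℚ.*-zeroˡ T))
sum-bound {suc n} v C T p h = ℚ.≤-trans
  (ℚ.∣p+q∣≤∣p∣+∣q∣ (seq (v zero) p) (seq (sum (λ i → v (suc i))) p))
  (subst (_ ≤_)
    (trans (sym (ℚ.*-distribʳ-+ T (fromℕ C) (fromℕ (n ℕ.* C))))
      (cong (_* T) (sym (fromℕ-+ C (n ℕ.* C)))))
    (ℚ.+-mono-≤ (h zero) (sum-bound (λ i → v (suc i)) C T p (λ l → h (suc l)))))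

module PowerBound {n} (A : Matrix n) where

  C : ℕ
  C = proj₁ (fin-bound λ i → proj₁ (fin-bound λ j → proj₁ (bounded (A i j))))

  entry-bound : ∀ i j p → ∣ seq (A i j) p ∣ ≤ fromℕ C
  entry-bound i j p = ℚ.≤-trans (proj₂ (bounded (A i j)) p) (fromℕ-mono-≤ (ℕ.≤-trans
    (proj₂ (fin-bound λ j → proj₁ (bounded (A i j))) j)
    (proj₂ (fin-bound λ i → proj₁ (fin-bound λ j → proj₁ (bounded (A i j)))) i)))

  b : ℕ
  b = n ℕ.* C

  pow : ℕ → ℚ
  pow zero    = 1ℚ
  pow (suc k) = fromℕ b * pow k

  0≤pow : ∀ k → 0ℚ ≤ pow k
  0≤pow zero    = ℚ.<⇒≤ 0<1
  0≤pow (suc k) = 0≤* (0≤fromℕ b) (0≤pow k)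

  ^-bound : ∀ k i j p → ∣ seq ((A ^ᴹ k) i j) p ∣ ≤ pow k
  ^-bound zero i j p with does (i Fin.≟ j)
  ... | true  = ℚ.≤-refl
  ... | false = ℚ.<⇒≤ 0<1
  ^-bound (suc k) i j p = sum-bound (λ l → A i l *ᴿ (A ^ᴹ k) l j) C (pow k) p λ l →
    subst (_≤ fromℕ C * pow k) (sym (ℚ.∣p*q∣≡∣p∣*∣q∣ (seq (A i l) p) (seq ((A ^ᴹ k) l j) p)))
      (*-mono-≤ (ℚ.0≤∣p∣ (seq (A i l) p)) (0≤pow k) (entry-bound i l p) (^-bound k l j p))

  0≤inv! : ∀ k → 0ℚ ≤ inv! k
  0≤inv! k = ℚ.nonNegative⁻¹ (inv! k) {{ℚ.normalize-nonNeg 1 (k !) {{k ℕ.!≢0}}}}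

  inv!-suc : ∀ k → inv! (suc k) * fromℕ (suc k) ≡ inv! k
  inv!-suc k = 1/n*m (suc k) (k !) {{_}} {{k ℕ.!≢0}} {{suc k ℕ.!≢0}}

  t : ℕ → ℕ → ℚ
  t d k = inv! k * pow (d ℕ.+ k)

  inv!-ratio : ∀ k → b ℕ.+ b ℕ.≤ k → inv! (suc k) * fromℕ b ≤ inv! k * ½
  inv!-ratio k 2b≤k = subst₂ _≤_ (twice (inv! (suc k)) (fromℕ b))
    (cong (_* ½) (inv!-suc k))
    (ℚ.*-monoʳ-≤-nonNeg ½
      (ℚ.*-monoˡ-≤-nonNeg (inv! (suc k)) {{nonNegative (0≤inv! (suc k))}}
        (subst (_≤ fromℕ (suc k)) (fromℕ-+ b b) (fromℕ-mono-≤ (ℕ.m≤n⇒m≤1+n 2b≤k)))))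
    where
    twice : ∀ u v → u * (v + v) * ½ ≡ u * v
    twice u v = trans (ℚ.*-assoc u (v + v) ½)
      (cong (u *_) (trans (ℚ.*-distribʳ-+ ½ v v) (halves v)))

  t-ratio : ∀ d k → b ℕ.+ b ℕ.≤ k → t d (suc k) ≤ t d k * ½
  t-ratio d k 2b≤k = subst₂ _≤_
    (trans (ℚ.*-assoc (inv! (suc k)) (fromℕ b) (pow (d ℕ.+ k)))
      (cong (λ m → inv! (suc k) * pow m) (sym (ℕ.+-suc d k))))
    (swap (inv! k) ½ (pow (d ℕ.+ k)))
    (ℚ.*-monoʳ-≤-nonNeg (pow (d ℕ.+ k)) {{nonNegative (0≤pow (d ℕ.+ k))}} (inv!-ratio k 2b≤k))
    where
    open +-*-Solver
    swap : ∀ u v w → u * v * w ≡ u * w * v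
    swap = solve 3 (λ u v w → u :* v :* w := u :* w :* v) refl

  summable : ∀ d → Summableᴹ (λ k → fromℚ (inv! k) ·ᴹ A ^ᴹ (d ℕ.+ k))
  summable d i j = RatioTest.summable
    (λ k → fromℚ (inv! k) *ᴿ (A ^ᴹ (d ℕ.+ k)) i j) (t d) (b ℕ.+ b)
    (λ k p → subst (_≤ t d k)
      (sym (trans (ℚ.∣p*q∣≡∣p∣*∣q∣ (inv! k) (seq ((A ^ᴹ (d ℕ.+ k)) i j) p))
        (cong (_* ∣ seq ((A ^ᴹ (d ℕ.+ k)) i j) p ∣) (ℚ.0≤p⇒∣p∣≡p (0≤inv! k)))))
      (ℚ.*-monoˡ-≤-nonNeg (inv! k) {{nonNegative (0≤inv! k)}} (^-bound (d ℕ.+ k) i j p)))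
    (t-ratio d)

------------------------------------------------------------------------
-- The matrix exponential and the potential gain

exp : ∀ {n} → Matrix n → Matrix n
exp A = ∑∞ᴹ (λ k → fromℚ (inv! k) ·ᴹ A ^ᴹ k) (PowerBound.summable A 0)

-- The sum over k ≥ 1 is reindexed by k ↦ suc k.
GainSeries : ∀ {n} → (ℕ → ℝ) → Matrix n → ℕ → Matrix n
GainSeries φ A k = φ (suc k) ·ᴹ A ^ᴹ suc k

potentialGain : ∀ {n} (φ : ℕ → ℝ) (A : Matrix n) → Summableᴹ (GainSeries φ A) → Vector ℝ n
potentialGain φ A s = ∑∞ᴹ (GainSeries φ A) s *ᵛ 𝟏

-- 1/(k-1)! for k ≥ 1; the value at 0 is never used.
exponentialWeight : ℕ → ℝ
exponentialWeight k = fromℚ (inv! (k ∸ 1))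

exponentialGain : ∀ {n} → Matrix n → Vector ℝ n
exponentialGain A = potentialGain exponentialWeight A (PowerBound.summable A 1)

------------------------------------------------------------------------
-- Graphs

-- Undirected graphs on the nodes Fin n; loops are allowed.
record Graph (n : ℕ) : Set₁ where
  field
    _~_   : Rel (Fin n) 0ℓ
    ~-sym : Symmetric _~_
    _~?_  : Decidable _~_

adjacency : ∀ {n} → Graph n → Matrix n
adjacency G i j = if does (i ~? j) then 1ℝ else 0ℝ
  where open Graph G

{-# OPTIONS --safe #-}
module Submission where

-- Term by term, Aᵏ⁺¹/k! = A (Aᵏ/k!), so the theorem says that left
-- multiplication by A can be taken out of an infinite series (∑∞ᴹ-*ᴹ).
-- An entry of A B is a finite sum of products of an entry of A with an entry
-- of B, hence it is enough that series of reals may be scaled by a constant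
-- (sumsTo-*) and added finitely often (sumsTo-sum).  Both hold for partial
-- sums, being identities in a semiring, and pass to the limit because limits
-- respect _≃_, addition and scaling, and are unique up to _≃_.
--
-- All estimates are reduced to one relation, Close ε x y, saying that the
-- Cauchy sequences of x and y eventually differ by less than ε: x ≃ y means
-- Close ε x y for all ε > 0, and x ⟶ l means that for each ε > 0 eventually
-- Close ε (x n) l.

open import Defs
open import Algebra.Bundles using (CommutativeSemiring)
import Algebra.Properties.CommutativeSemigroup as CommutativeSemigroupProperties
import Algebra.Properties.Semiring.Sum as SemiringSum
open import Algebra.Structures.Biased using (isCommutativeSemiringˡ)
open import Data.Fin.Base using (Fin; zero; suc)
open import Data.Nat.Base as ℕ using (ℕ; zero; suc; _⊔_)
import Data.Nat.Properties as ℕ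
open import Data.Product.Base using (∃; _×_; _,_)
open import Data.Rational.Base
  using (ℚ; 0ℚ; ½; _+_; _*_; _-_; 1/_; ∣_∣; _≤_; _<_; positive; nonNegative)
import Data.Rational.Properties as ℚ
open import Data.Rational.Solver using (module +-*-Solver)
open import Data.Vec.Functional using (Vector)
open import Level using (0ℓ)
open import Relation.Binary.Core using (Rel)
open import Relation.Binary.Structures using (IsEquivalence)
open import Relation.Binary.PropositionalEquality
  using (_≡_; refl; sym; trans; cong; subst; subst₂)

-- Eventual closeness of Cauchy sequences

-- The sequences representing x and y eventually differ by less than ε.
Close : ℚ → ℝ → ℝ → Set
Close ε x y = ∃ λ N → ∀ n → N ℕ.≤ n → ∣ seq x n - seq y n ∣ < ε

close-sym : ∀ {ε} x y → Close ε x y → Close ε y x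
close-sym {ε} x y (N , h) = N , λ n N≤n →
  subst (_< ε) (∣-∣-comm (seq x n) (seq y n)) (h n N≤n)

close-trans : ∀ {δ ε} x y z → Close δ x y → Close ε y z → Close (δ + ε) x z
close-trans x y z (N₁ , h₁) (N₂ , h₂) = N₁ ⊔ N₂ , λ n N≤n →
  ℚ.≤-<-trans (∣-∣-triangle (seq x n) (seq y n) (seq z n))
    (ℚ.+-mono-< (h₁ n (ℕ.m⊔n≤o⇒m≤o N₁ N₂ N≤n)) (h₂ n (ℕ.m⊔n≤o⇒n≤o N₁ N₂ N≤n)))

close-+ : ∀ {δ ε} x x′ y y′ → Close δ x x′ → Close ε y y′ → Close (δ + ε) (x +ᴿ y) (x′ +ᴿ y′)
close-+ x x′ y y′ (N₁ , h₁) (N₂ , h₂) = N₁ ⊔ N₂ , λ n N≤n →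
  ℚ.≤-<-trans
    (subst (λ s → ∣ s ∣ ≤ ∣ seq x n - seq x′ n ∣ + ∣ seq y n - seq y′ n ∣)
      (rearrange (seq x n) (seq x′ n) (seq y n) (seq y′ n))
      (ℚ.∣p+q∣≤∣p∣+∣q∣ (seq x n - seq x′ n) (seq y n - seq y′ n)))
    (ℚ.+-mono-< (h₁ n (ℕ.m⊔n≤o⇒m≤o N₁ N₂ N≤n)) (h₂ n (ℕ.m⊔n≤o⇒n≤o N₁ N₂ N≤n)))
  where
  open +-*-Solver
  rearrange : ∀ a b c d → (a - b) + (c - d) ≡ (a + c) - (b + d)
  rearrange = solve 4 (λ a b c d → (a :- b) :+ (c :- d) := (a :+ c) :- (b :+ d)) refl

-- Scaling by c is uniformly continuous, as the sequence of c is bounded.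
close-* : ∀ c ε → 0ℚ < ε → ∃ λ δ → 0ℚ < δ × (∀ x y → Close δ x y → Close ε (c *ᴿ x) (c *ᴿ y))
close-* c ε 0<ε with bounded c
... | b , ∣c∣≤b = ε * 1/ K , 0<* 0<ε (ℚ.positive⁻¹ (1/ K) {{ℚ.1/pos⇒pos K}}) , scale
  where
  -- A bound of c is increased by one to make it positive.
  K : ℚ
  K = fromℕ (suc b)
  instance
    K-positive = positive (0<fromℕ-suc b)
    K≢0 = ℚ.pos⇒nonZero K
  K*δ≡ε : K * (ε * 1/ K) ≡ ε
  K*δ≡ε = trans (ℚ.*-comm K (ε * 1/ K)) (trans (ℚ.*-assoc ε (1/ K) K)
    (trans (cong (ε *_) (ℚ.*-inverseˡ K)) (ℚ.*-identityʳ ε)))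
  factor : ∀ p q r → ∣ p ∣ * ∣ q - r ∣ ≡ ∣ p * q - p * r ∣
  factor p q r = trans (sym (ℚ.∣p*q∣≡∣p∣*∣q∣ p (q - r)))
    (cong ∣_∣ (solve 3 (λ p q r → p :* (q :- r) := p :* q :- p :* r) refl p q r))
    where open +-*-Solver
  scale : ∀ x y → Close (ε * 1/ K) x y → Close ε (c *ᴿ x) (c *ᴿ y)
  scale x y (N , h) = N , λ n N≤n → subst₂ _<_ (factor (seq c n) (seq x n) (seq y n)) K*δ≡ε
    (ℚ.≤-<-trans
      (ℚ.*-monoʳ-≤-nonNeg ∣ seq x n - seq y n ∣ {{nonNegative (ℚ.0≤∣p∣ (seq x n - seq y n))}}
        (ℚ.≤-trans (∣c∣≤b n) (fromℕ-mono-≤ (ℕ.n≤1+n b))))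
      (ℚ.*-monoʳ-<-pos K (h n N≤n)))

-- Two approximations within ε/2 combine to one within ε.
by-halves : ∀ {x y u v z w} →
  (∀ {δ ε} → Close δ x y → Close ε u v → Close (δ + ε) z w) →
  ∀ ε → Close (ε * ½) x y → Close (ε * ½) u v → Close ε z w
by-halves {z = z} {w} combine ε p q = subst (λ δ → Close δ z w) (halves ε) (combine p q)

0<ε½ : ∀ {ε} → 0ℚ < ε → 0ℚ < ε * ½
0<ε½ 0<ε = 0<* 0<ε 0<½

-- The commutative semiring of real numbers

≃-pointwise : ∀ {x y} → (∀ n → seq x n ≡ seq y n) → x ≃ y
≃-pointwise {x} {y} x≡y ε 0<ε = 0 , λ n _ →
  subst (_< ε) (sym (trans (cong (λ q → ∣ q - seq y n ∣) (x≡y n)) (∣p-p∣≡0 (seq y n)))) 0<ε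

≃-sym : ∀ {x y} → x ≃ y → y ≃ x
≃-sym {x} {y} x≃y ε 0<ε = close-sym x y (x≃y ε 0<ε)

≃-trans : ∀ {x y z} → x ≃ y → y ≃ z → x ≃ z
≃-trans {x} {y} {z} x≃y y≃z ε 0<ε =
  by-halves {x} {y} {y} {z} {x} {z} (close-trans x y z) ε (x≃y _ (0<ε½ 0<ε)) (y≃z _ (0<ε½ 0<ε))

+-cong : ∀ {x x′ y y′} → x ≃ x′ → y ≃ y′ → x +ᴿ y ≃ x′ +ᴿ y′
+-cong {x} {x′} {y} {y′} x≃x′ y≃y′ ε 0<ε =
  by-halves {x} {x′} {y} {y′} {x +ᴿ y} {x′ +ᴿ y′} (close-+ x x′ y y′) ε
    (x≃x′ _ (0<ε½ 0<ε)) (y≃y′ _ (0<ε½ 0<ε))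

*-congˡ : ∀ {c x y} → x ≃ y → c *ᴿ x ≃ c *ᴿ y
*-congˡ {c} {x} {y} x≃y ε 0<ε =
  let (δ , 0<δ , scale) = close-* c ε 0<ε in scale x y (x≃y δ 0<δ)

*-comm : ∀ x y → x *ᴿ y ≃ y *ᴿ x
*-comm x y = ≃-pointwise {x *ᴿ y} {y *ᴿ x} λ n → ℚ.*-comm (seq x n) (seq y n)

*-cong : ∀ {x x′ y y′} → x ≃ x′ → y ≃ y′ → x *ᴿ y ≃ x′ *ᴿ y′
*-cong {x} {x′} {y} {y′} x≃x′ y≃y′ =
  ≃-trans {x *ᴿ y} {x *ᴿ y′} {x′ *ᴿ y′} (*-congˡ {x} {y} {y′} y≃y′)
    (≃-trans {x *ᴿ y′} {y′ *ᴿ x} {x′ *ᴿ y′} (*-comm x y′)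
      (≃-trans {y′ *ᴿ x} {y′ *ᴿ x′} {x′ *ᴿ y′} (*-congˡ {y′} {x} {x′} x≃x′) (*-comm y′ x′)))

-- The operations act termwise, so the laws are those of the rationals.
ℝ-commutativeSemiring : CommutativeSemiring 0ℓ 0ℓ
ℝ-commutativeSemiring = record
  { Carrier = ℝ
  ; _≈_     = _≃_
  ; _+_     = _+ᴿ_
  ; _*_     = _*ᴿ_
  ; 0#      = 0ℝ
  ; 1#      = 1ℝ
  ; isCommutativeSemiring = isCommutativeSemiringˡ record
    { +-isCommutativeMonoid = record
      { isMonoid = record
        { isSemigroup = record
          { isMagma = record
            { isEquivalence = isEquivalence
            ; ∙-cong = λ {x} {x′} {y} {y′} → +-cong {x} {x′} {y} {y′}
            }
          ; assoc = λ x y z → pointwise ((x +ᴿ y) +ᴿ z) (x +ᴿ (y +ᴿ z))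
              λ n → ℚ.+-assoc (seq x n) (seq y n) (seq z n)
          }
        ; identity = (λ x → pointwise (0ℝ +ᴿ x) x λ n → ℚ.+-identityˡ (seq x n))
                   , (λ x → pointwise (x +ᴿ 0ℝ) x λ n → ℚ.+-identityʳ (seq x n))
        }
      ; comm = λ x y → pointwise (x +ᴿ y) (y +ᴿ x) λ n → ℚ.+-comm (seq x n) (seq y n)
      }
    ; *-isCommutativeMonoid = record
      { isMonoid = record
        { isSemigroup = record
          { isMagma = record
            { isEquivalence = isEquivalence
            ; ∙-cong = λ {x} {x′} {y} {y′} → *-cong {x} {x′} {y} {y′}
            }
          ; assoc = λ x y z → pointwise ((x *ᴿ y) *ᴿ z) (x *ᴿ (y *ᴿ z))
              λ n → ℚ.*-assoc (seq x n) (seq y n) (seq z n)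
          }
        ; identity = (λ x → pointwise (1ℝ *ᴿ x) x λ n → ℚ.*-identityˡ (seq x n))
                   , (λ x → pointwise (x *ᴿ 1ℝ) x λ n → ℚ.*-identityʳ (seq x n))
        }
      ; comm = *-comm
      }
    ; distribʳ = λ z x y → pointwise ((x +ᴿ y) *ᴿ z) (x *ᴿ z +ᴿ y *ᴿ z)
        λ n → ℚ.*-distribʳ-+ (seq z n) (seq x n) (seq y n)
    ; zeroˡ = λ x → pointwise (0ℝ *ᴿ x) 0ℝ λ n → ℚ.*-zeroˡ (seq x n)
    }
  }
  where
  pointwise : ∀ x y → (∀ n → seq x n ≡ seq y n) → x ≃ y
  pointwise x y = ≃-pointwise {x} {y}
  isEquivalence : IsEquivalence _≃_
  isEquivalence = record
    { refl  = λ {x} → pointwise x x λ _ → refl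
    ; sym   = λ {x} {y} → ≃-sym {x} {y}
    ; trans = λ {x} {y} {z} → ≃-trans {x} {y} {z}
    }

module R = CommutativeSemiring ℝ-commutativeSemiring
open SemiringSum R.semiring using (sum-cong-≋; *-distribˡ-sum)
open CommutativeSemigroupProperties R.+-commutativeSemigroup
  using () renaming (interchange to +-interchange)
open CommutativeSemigroupProperties R.*-commutativeSemigroup
  using () renaming (x∙yz≈y∙xz to x*yz≃y*xz)

-- Limits of real sequences

⟶⇒close : ∀ {x l} → x ⟶ l → ∀ ε → 0ℚ < ε → ∃ λ N → ∀ n → N ℕ.≤ n → Close ε (x n) l
⟶⇒close {x} {l} x⟶l ε 0<ε =
  -- A quarter for each of the two margins, so that their sum is strictly below ε.
  let δ = ε * ½ * ½
      0<δ = 0<ε½ (0<ε½ 0<ε)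
      (N , h) = x⟶l δ 0<δ
  in N , λ n N≤n → let (P , g) = h n N≤n δ 0<δ in P , λ i P≤i →
    ℚ.≤-<-trans (g i P≤i)
      (subst₂ _<_ (sym (halves (ε * ½))) (halves ε)
        (subst (_< ε * ½ + ε * ½) (ℚ.+-identityʳ (ε * ½)) (ℚ.+-monoʳ-< (ε * ½) (0<ε½ 0<ε))))

close⇒⟶ : ∀ {x l} → (∀ ε → 0ℚ < ε → ∃ λ N → ∀ n → N ℕ.≤ n → Close ε (x n) l) → x ⟶ l
close⇒⟶ h ε 0<ε = let (N , g) = h ε 0<ε in N , λ n N≤n ε′ 0<ε′ →
  let (P , k) = g n N≤n in P , λ i P≤i →
    ℚ.≤-trans (ℚ.<⇒≤ (k i P≤i))
      (subst (_≤ ε + ε′) (ℚ.+-identityʳ ε) (ℚ.+-monoʳ-≤ ε (ℚ.<⇒≤ 0<ε′)))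

⟶-unique : ∀ {x l m} → x ⟶ l → x ⟶ m → l ≃ m
⟶-unique {x} {l} {m} x⟶l x⟶m ε 0<ε =
  let (N₁ , h₁) = ⟶⇒close {x} {l} x⟶l (ε * ½) (0<ε½ 0<ε)
      (N₂ , h₂) = ⟶⇒close {x} {m} x⟶m (ε * ½) (0<ε½ 0<ε)
      n = N₁ ⊔ N₂
  in by-halves {l} {x n} {x n} {m} {l} {m} (close-trans l (x n) m) ε
       (close-sym (x n) l (h₁ n (ℕ.m≤m⊔n N₁ N₂))) (h₂ n (ℕ.m≤n⊔m N₁ N₂))

⟶-cong : ∀ {x y l} → (∀ n → y n ≃ x n) → x ⟶ l → y ⟶ l
⟶-cong {x} {y} {l} y≃x x⟶l = close⇒⟶ {y} {l} λ ε 0<ε →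
  let (N , h) = ⟶⇒close {x} {l} x⟶l (ε * ½) (0<ε½ 0<ε)
  in N , λ n N≤n → by-halves {y n} {x n} {x n} {l} {y n} {l} (close-trans (y n) (x n) l) ε
       (y≃x n _ (0<ε½ 0<ε)) (h n N≤n)

⟶-const : ∀ l → (λ _ → l) ⟶ l
⟶-const l = close⇒⟶ {λ _ → l} {l} λ ε 0<ε → 0 , λ _ _ → R.refl {l} ε 0<ε

⟶-+ : ∀ {x y l m} → x ⟶ l → y ⟶ m → (λ n → x n +ᴿ y n) ⟶ l +ᴿ m
⟶-+ {x} {y} {l} {m} x⟶l y⟶m = close⇒⟶ {λ n → x n +ᴿ y n} {l +ᴿ m} λ ε 0<ε →
  let (N₁ , h₁) = ⟶⇒close {x} {l} x⟶l (ε * ½) (0<ε½ 0<ε)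
      (N₂ , h₂) = ⟶⇒close {y} {m} y⟶m (ε * ½) (0<ε½ 0<ε)
  in N₁ ⊔ N₂ , λ n N≤n →
       by-halves {x n} {l} {y n} {m} {x n +ᴿ y n} {l +ᴿ m} (close-+ (x n) l (y n) m) ε
         (h₁ n (ℕ.m⊔n≤o⇒m≤o N₁ N₂ N≤n)) (h₂ n (ℕ.m⊔n≤o⇒n≤o N₁ N₂ N≤n))

⟶-* : ∀ {x l} c → x ⟶ l → (λ n → c *ᴿ x n) ⟶ c *ᴿ l
⟶-* {x} {l} c x⟶l = close⇒⟶ {λ n → c *ᴿ x n} {c *ᴿ l} λ ε 0<ε →
  let (δ , 0<δ , scale) = close-* c ε 0<ε
      (N , h) = ⟶⇒close {x} {l} x⟶l δ 0<δ
  in N , λ n N≤n → scale (x n) l (h n N≤n)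

-- Linearity of series

partialSum-cong : ∀ {a b} → (∀ k → a k ≃ b k) → ∀ n → partialSum a n ≃ partialSum b n
partialSum-cong a≃b zero = R.refl {0ℝ}
partialSum-cong {a} {b} a≃b (suc n) =
  +-cong {partialSum a n} {partialSum b n} {a n} {b n} (partialSum-cong {a} {b} a≃b n) (a≃b n)

partialSum-0 : ∀ n → partialSum (λ _ → 0ℝ) n ≃ 0ℝ
partialSum-0 zero = R.refl {0ℝ}
partialSum-0 (suc n) = R.trans {s +ᴿ 0ℝ} {s} {0ℝ} (R.+-identityʳ s) (partialSum-0 n)
  where s = partialSum (λ _ → 0ℝ) n

partialSum-+ : ∀ a b n → partialSum (λ k → a k +ᴿ b k) n ≃ partialSum a n +ᴿ partialSum b n
partialSum-+ a b zero = R.sym {0ℝ +ᴿ 0ℝ} {0ℝ} (R.+-identityʳ 0ℝ)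
partialSum-+ a b (suc n) = begin
  partialSum (λ k → a k +ᴿ b k) n +ᴿ (a n +ᴿ b n)
    ≈⟨ +-cong {partialSum (λ k → a k +ᴿ b k) n} {A +ᴿ B} {a n +ᴿ b n} {a n +ᴿ b n}
         (partialSum-+ a b n) (R.refl {a n +ᴿ b n}) ⟩
  (A +ᴿ B) +ᴿ (a n +ᴿ b n)
    ≈⟨ +-interchange A B (a n) (b n) ⟩
  (A +ᴿ a n) +ᴿ (B +ᴿ b n) ∎
  where
  open import Relation.Binary.Reasoning.Setoid R.setoid
  A = partialSum a n
  B = partialSum b n

partialSum-* : ∀ c a n → partialSum (λ k → c *ᴿ a k) n ≃ c *ᴿ partialSum a n
partialSum-* c a zero = R.sym {c *ᴿ 0ℝ} {0ℝ} (R.zeroʳ c)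
partialSum-* c a (suc n) = begin
  partialSum (λ k → c *ᴿ a k) n +ᴿ c *ᴿ a n
    ≈⟨ +-cong {partialSum (λ k → c *ᴿ a k) n} {c *ᴿ A} {c *ᴿ a n} {c *ᴿ a n}
         (partialSum-* c a n) (R.refl {c *ᴿ a n}) ⟩
  c *ᴿ A +ᴿ c *ᴿ a n
    ≈⟨ R.distribˡ c A (a n) ⟨
  c *ᴿ (A +ᴿ a n) ∎
  where
  open import Relation.Binary.Reasoning.Setoid R.setoid
  A = partialSum a n

infix 4 _sumsTo_

-- The series with terms a 0, a 1, ... converges to s.
_sumsTo_ : (ℕ → ℝ) → ℝ → Set
a sumsTo s = partialSum a ⟶ s

sumsTo-cong : ∀ {a b s} → (∀ k → b k ≃ a k) → a sumsTo s → b sumsTo s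
sumsTo-cong {a} {b} {s} b≃a =
  ⟶-cong {partialSum a} {partialSum b} {s} (partialSum-cong {b} {a} b≃a)

sumsTo-* : ∀ {a s} c → a sumsTo s → (λ k → c *ᴿ a k) sumsTo c *ᴿ s
sumsTo-* {a} {s} c a⟶s =
  ⟶-cong {λ n → c *ᴿ partialSum a n} {partialSum (λ k → c *ᴿ a k)} {c *ᴿ s}
    (partialSum-* c a) (⟶-* {partialSum a} {s} c a⟶s)

sumsTo-sum : ∀ {m} (a : Fin m → ℕ → ℝ) (s : Vector ℝ m) →
             (∀ l → a l sumsTo s l) → (λ k → sum (λ l → a l k)) sumsTo sum s
sumsTo-sum {zero} a s h =
  ⟶-cong {λ _ → 0ℝ} {partialSum (λ _ → 0ℝ)} {0ℝ} partialSum-0 (⟶-const 0ℝ)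
sumsTo-sum {suc m} a s h =
  ⟶-cong {λ n → partialSum (a zero) n +ᴿ partialSum a′ n}
    {partialSum (λ k → a zero k +ᴿ a′ k)} {s zero +ᴿ sum s′}
    (partialSum-+ (a zero) a′)
    (⟶-+ {partialSum (a zero)} {partialSum a′} {s zero} {sum s′}
      (h zero) (sumsTo-sum (λ l → a (suc l)) s′ (λ l → h (suc l))))
  where
  a′ : ℕ → ℝ
  a′ k = sum (λ l → a (suc l) k)
  s′ : Vector ℝ m
  s′ l = s (suc l)

-- Matrices

infix 4 _≃ᴹ_

-- Entrywise equality of matrices.
_≃ᴹ_ : ∀ {n} → Rel (Matrix n) 0ℓ
A ≃ᴹ B = ∀ i j → A i j ≃ B i j

*ᵛ-congʳ : ∀ {n} {A B : Matrix n} (v : Vector ℝ n) → A ≃ᴹ B → A *ᵛ v ≃ᵛ B *ᵛ v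
*ᵛ-congʳ {A = A} {B} v A≃B i =
  sum-cong-≋ {x = λ j → A i j *ᴿ v j} {y = λ j → B i j *ᴿ v j}
    λ j → *-cong {A i j} {B i j} {v j} {v j} (A≃B i j) (R.refl {v j})

·ᴹ-*ᴹ : ∀ {n} c (A B : Matrix n) → c ·ᴹ (A *ᴹ B) ≃ᴹ A *ᴹ (c ·ᴹ B)
·ᴹ-*ᴹ c A B i j = begin
  c *ᴿ sum (λ l → A i l *ᴿ B l j)
    ≈⟨ *-distribˡ-sum c (λ l → A i l *ᴿ B l j) ⟩
  sum (λ l → c *ᴿ (A i l *ᴿ B l j))
    ≈⟨ sum-cong-≋ {x = λ l → c *ᴿ (A i l *ᴿ B l j)} {y = λ l → A i l *ᴿ (c *ᴿ B l j)}
         (λ l → x*yz≃y*xz c (A i l) (B l j)) ⟩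
  sum (λ l → A i l *ᴿ (c *ᴿ B l j)) ∎
  where open import Relation.Binary.Reasoning.Setoid R.setoid

-- Left multiplication by a matrix commutes with the sum of a series.
∑∞ᴹ-*ᴹ : ∀ {n} (A : Matrix n) (F G : ℕ → Matrix n) (s : Summableᴹ F) (t : Summableᴹ G) →
         (∀ k → G k ≃ᴹ A *ᴹ F k) → ∑∞ᴹ G t ≃ᴹ A *ᴹ ∑∞ᴹ F s
∑∞ᴹ-*ᴹ A F G s t G≃AF i j =
  ⟶-unique {partialSum g} {∑∞ᴹ G t i j} {(A *ᴹ ∑∞ᴹ F s) i j}
    (lim-converges (partialSum g) (t i j))
    (sumsTo-cong {λ k → (A *ᴹ F k) i j} {g} {(A *ᴹ ∑∞ᴹ F s) i j} (λ k → G≃AF k i j)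
      (sumsTo-sum (λ l k → A i l *ᴿ F k l j) (λ l → A i l *ᴿ ∑∞ᴹ F s l j)
        λ l → sumsTo-* {λ k → F k l j} {∑∞ᴹ F s l j} (A i l)
          (lim-converges (partialSum (λ k → F k l j)) (s l j))))
  where
  g : ℕ → ℝ
  g k = G k i j

exponentialGainSeries-term : ∀ {n} (A : Matrix n) k →
  GainSeries exponentialWeight A k ≃ᴹ A *ᴹ (fromℚ (inv! k) ·ᴹ A ^ᴹ k)
exponentialGainSeries-term A k = ·ᴹ-*ᴹ (fromℚ (inv! k)) A (A ^ᴹ k)

∑∞ᴹ-exponentialGainSeries : ∀ {n} (A : Matrix n) →
  ∑∞ᴹ (GainSeries exponentialWeight A) (PowerBound.summable A 1) ≃ᴹ A *ᴹ exp A
∑∞ᴹ-exponentialGainSeries A =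
  ∑∞ᴹ-*ᴹ A (λ k → fromℚ (inv! k) ·ᴹ A ^ᴹ k) (GainSeries exponentialWeight A)
    (PowerBound.summable A 0) (PowerBound.summable A 1) (exponentialGainSeries-term A)

exponentialGain≃ : ∀ {n} (A : Matrix n) → exponentialGain A ≃ᵛ (A *ᴹ exp A) *ᵛ 𝟏
exponentialGain≃ A =
  *ᵛ-congʳ {A = ∑∞ᴹ (GainSeries exponentialWeight A) (PowerBound.summable A 1)}
    {B = A *ᴹ exp A} 𝟏 (∑∞ᴹ-exponentialGainSeries A)

mainTheorem2 : (n : ℕ) (G : Graph n) →
    exponentialGain (adjacency G) ≃ᵛ (adjacency G *ᴹ exp (adjacency G)) *ᵛ 𝟏
mainTheorem2 n G = exponentialGain≃ (adjacency G)
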